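{- For any natural number $k$, the class of finite simple graphs $\{ G \mid c_2(G)\leq k \}$ is defined by forbidding a finite set of induced subgraphs; that is, there is a finite set $M$ of finite simple graphs such that, for every finite simple graph $G$, $c_2(G)\leq k$ if and only if no induced subgraph of $G$ is isomorphic to a graph in $M$.
   Context: All graphs are finite and simple. A subgraph complementation system for a graph $G=(V,E)$ is a finite collection (family) $\mathscr{C}$ of subsets of $V$ such that, for any two distinct vertices $u,v\in V$, $uv\in E$ if and only if $u$ and $v$ appear together in an odd number of sets in $\mathscr{C}$. The subgraph complementation number $c_2(G)$ is the minimum cardinality of a subgraph complementation system for $G$. -}

module Defs where

open import Data.Bool.Base using (true; false)
open import Data.Fin.Base using (Fin; zero; suc)
import Data.Fin.Properties as Fin
open import Data.Fin.Subset using (Subset; inside; outside; _∈_)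
open import Data.Fin.Subset.Properties using (_∈?_; anySubset?)
open import Data.List.Base using (List; []; _∷_; length; map; filter)
open import Data.Nat.Base using (ℕ; zero; suc; _≤_; z≤n; s≤s; parity)
open import Data.Nat.Properties using (suc-injective)
open import Data.Parity.Base using (1ℙ)
import Data.Parity.Properties as Parity
open import Data.Product.Base using (∃; _×_; _,_; proj₁; proj₂)
open import Data.Vec.Base using (tabulate) renaming (_∷_ to _∷ᵛ_)
open import Data.Vec.Properties using ([]=⇒lookup; lookup⇒[]=; lookup∘tabulate)
open import Function.Base using (_∘_)
open import Function.Bundles using (_⇔_; mk⇔; _↔_; module Equivalence; module Inverse)
open import Level using (0ℓ)
open import Relation.Binary.Core using (Rel)
open import Relation.Binary.Definitions
  using (Symmetric; Irreflexive) renaming (Decidable to Decidable₂)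
open import Relation.Binary.PropositionalEquality
  using (_≡_; _≢_; refl; sym; trans; cong)
open import Relation.Nullary.Decidable
  using (Dec; yes; no; does; map′; ¬?; _×-dec_; _→-dec_; dec-true)
open import Relation.Nullary.Negation using (contradiction)
open import Relation.Unary using (Pred; Decidable)

-- Decidability of adjacency is automatic classically.
record SimpleGraph (V : Set) : Set₁ where
  infix 4 _∼_ _∼?_
  field
    _∼_      : Rel V 0ℓ
    ∼-sym    : Symmetric _∼_
    ∼-irrefl : Irreflexive _≡_ _∼_
    _∼?_     : Decidable₂ _∼_

open SimpleGraph

-- Every finite simple graph is, up to isomorphism, of this form.
FiniteGraph : Set₁
FiniteGraph = ∃ λ n → SimpleGraph (Fin n)

infix 4 _≅_

record _≅_ {V W : Set} (G : SimpleGraph V) (H : SimpleGraph W) : Set where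
  field
    bijection : V ↔ W
    adjacency : ∀ u v →
      (G ._∼_ u v) ⇔ (H ._∼_ (Inverse.to bijection u) (Inverse.to bijection v))

-- S [ i ]= inside is a proposition, so ∃ (_∈ S) has exactly one element for
-- each element of S.
infix 8 _[_]

_[_] : ∀ {n} → SimpleGraph (Fin n) → (S : Subset n) → SimpleGraph (∃ (_∈ S))
(G [ S ]) ._∼_  (u , _) (v , _)  = G ._∼_ u v
(G [ S ]) .∼-sym                 = G .∼-sym
(G [ S ]) .∼-irrefl u≡v          = G .∼-irrefl (cong proj₁ u≡v)
(G [ S ]) ._∼?_ (u , _) (v , _)  = G ._∼?_ u v

Odd : Pred ℕ 0ℓ
Odd m = parity m ≡ 1ℙ

-- A family of sets is a list, whose cardinality is its length. Repetitions are
-- allowed but do not affect the minimum: two equal members can be dropped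
-- together without changing any parity.
Family : ℕ → Set
Family n = List (Subset n)

both? : ∀ {n} (u v : Fin n) → Decidable {A = Subset n} (λ S → u ∈ S × v ∈ S)
both? u v S = (u ∈? S) ×-dec (v ∈? S)

together : ∀ {n} → Family n → Fin n → Fin n → ℕ
together 𝒞 u v = length (filter (both? u v) 𝒞)

IsSystem : ∀ {n} → SimpleGraph (Fin n) → Pred (Family n) 0ℓ
IsSystem G 𝒞 = ∀ u v → u ≢ v → (G ._∼_ u v) ⇔ Odd (together 𝒞 u v)

HasSystemOfSize : ∀ {n} → SimpleGraph (Fin n) → Pred ℕ 0ℓ
HasSystemOfSize {n} G m = ∃ λ (𝒞 : Family n) → length 𝒞 ≡ m × IsSystem G 𝒞

IsMinimum : Pred ℕ 0ℓ → Pred ℕ 0ℓ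
IsMinimum P m = P m × (∀ j → P j → m ≤ j)

minimum : ∀ {P : Pred ℕ 0ℓ} → Decidable P → ∀ b → P b → ∃ (IsMinimum P)
minimum P? b pb with P? 0
minimum P? b       pb | yes p0 = 0 , p0 , λ _ _ → z≤n
minimum P? zero    pb | no ¬p0 = contradiction pb ¬p0
minimum {P} P? (suc b) pb | no ¬p0 with minimum (P? ∘ suc) b pb
... | m , pm , least = suc m , pm , least′
  where
  least′ : ∀ j → P j → suc m ≤ j
  least′ zero    p0 = contradiction p0 ¬p0
  least′ (suc j) pj = s≤s (least j pj)

isSystem? : ∀ {n} (G : SimpleGraph (Fin n)) → Decidable (IsSystem G)
isSystem? G 𝒞 = Fin.all? λ u → Fin.all? λ v →
  ¬? (u Fin.≟ v) →-dec ((G ._∼?_ u v) ⇔-dec (parity (together 𝒞 u v) Parity.≟ 1ℙ))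
  where
  _⇔-dec_ : ∀ {A B : Set} → Dec A → Dec B → Dec (A ⇔ B)
  a? ⇔-dec b? = map′ (λ (f , g) → mk⇔ f g)
                     (λ e → Equivalence.to e , Equivalence.from e)
                     ((a? →-dec b?) ×-dec (b? →-dec a?))

anyFamily? : ∀ {n} {P : Pred (Family n) 0ℓ} → Decidable P →
             ∀ m → Dec (∃ λ 𝒞 → length 𝒞 ≡ m × P 𝒞)
anyFamily? P? zero =
  map′ (λ p → [] , refl , p) (λ { ([] , refl , p) → p }) (P? [])
anyFamily? P? (suc m) =
  map′ (λ { (S , 𝒞 , eq , p) → S ∷ 𝒞 , cong suc eq , p })
       (λ { (S ∷ 𝒞 , eq , p) → S , 𝒞 , suc-injective eq , p })
       (anySubset? λ S → anyFamily? (λ 𝒞 → P? (S ∷ 𝒞)) m)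

hasSystemOfSize? : ∀ {n} (G : SimpleGraph (Fin n)) → Decidable (HasSystemOfSize G)
hasSystemOfSize? G = anyFamily? (isSystem? G)

deleteZero : ∀ {n} → SimpleGraph (Fin (suc n)) → SimpleGraph (Fin n)
deleteZero G ._∼_ u v  = G ._∼_ (suc u) (suc v)
deleteZero G .∼-sym    = G .∼-sym
deleteZero G .∼-irrefl = G .∼-irrefl ∘ cong suc
deleteZero G ._∼?_ u v = G ._∼?_ (suc u) (suc v)

N₀ : ∀ {n} → SimpleGraph (Fin (suc n)) → Subset n
N₀ G = tabulate λ v → does (G ._∼?_ zero (suc v))

-- The sets {0} ∪ N(0) and N(0) together complement exactly the edges at 0.
edgeSystem : ∀ {n} → SimpleGraph (Fin n) → Family n
edgeSystem {zero}  G = []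
edgeSystem {suc n} G =
  (inside ∷ᵛ N₀ G) ∷ (outside ∷ᵛ N₀ G) ∷
  map (outside ∷ᵛ_) (edgeSystem (deleteZero G))

module _ {n} (G : SimpleGraph (Fin (suc n))) where

  ∈N₀⇒∼ : ∀ {v} → v ∈ N₀ G → G ._∼_ zero (suc v)
  ∈N₀⇒∼ {v} v∈N = witness (G ._∼?_ zero (suc v))
    (trans (sym (lookup∘tabulate _ v)) ([]=⇒lookup v∈N))
    where
    witness : ∀ {A : Set} (a? : Dec A) → does a? ≡ true → A
    witness (yes a) _ = a

  ∼⇒∈N₀ : ∀ {v} → G ._∼_ zero (suc v) → v ∈ N₀ G
  ∼⇒∈N₀ {v} 0∼v = lookup⇒[]= v (N₀ G)
    (trans (lookup∘tabulate _ v) (dec-true (G ._∼?_ zero (suc v)) 0∼v))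

together-comm : ∀ {n} (𝒞 : Family n) u v → together 𝒞 u v ≡ together 𝒞 v u
together-comm []      u v = refl
together-comm (S ∷ 𝒞) u v with does (u ∈? S) | does (v ∈? S)
... | true  | true  = cong suc (together-comm 𝒞 u v)
... | true  | false = together-comm 𝒞 u v
... | false | true  = together-comm 𝒞 u v
... | false | false = together-comm 𝒞 u v

together-map-suc : ∀ {n} (𝒞 : Family n) u v →
                   together (map (outside ∷ᵛ_) 𝒞) (suc u) (suc v) ≡ together 𝒞 u v
together-map-suc []      u v = refl
together-map-suc (S ∷ 𝒞) u v with does (u ∈? S) | does (v ∈? S)
... | true  | true  = cong suc (together-map-suc 𝒞 u v)
... | true  | false = together-map-suc 𝒞 u v
... | false | _     = together-map-suc 𝒞 u v

together-map-zero : ∀ {n} (𝒞 : Family n) v →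
                    together (map (outside ∷ᵛ_) 𝒞) zero v ≡ 0
together-map-zero []      v = refl
together-map-zero (S ∷ 𝒞) v = together-map-zero 𝒞 v

edgeSystem-suc : ∀ {n} (G : SimpleGraph (Fin (suc n))) u v →
  parity (together (edgeSystem G) (suc u) (suc v)) ≡
  parity (together (edgeSystem (deleteZero G)) u v)
edgeSystem-suc G u v with does (u ∈? N₀ G) in u? | does (v ∈? N₀ G) in v?
... | true  | true  rewrite u? | v? = cong parity (together-map-suc (edgeSystem (deleteZero G)) u v)
... | true  | false rewrite u? | v? = cong parity (together-map-suc (edgeSystem (deleteZero G)) u v)
... | false | _     rewrite u?      = cong parity (together-map-suc (edgeSystem (deleteZero G)) u v)

edgeSystem-zero : ∀ {n} (G : SimpleGraph (Fin (suc n))) v →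
  (G ._∼_ zero (suc v)) ⇔ Odd (together (edgeSystem G) zero (suc v))
edgeSystem-zero G v with v ∈? N₀ G
... | yes v∈N rewrite together-map-zero (edgeSystem (deleteZero G)) (suc v) =
  mk⇔ (λ _ → refl) (λ _ → ∈N₀⇒∼ G v∈N)
... | no v∉N  rewrite together-map-zero (edgeSystem (deleteZero G)) (suc v) =
  mk⇔ (λ 0∼v → contradiction (∼⇒∈N₀ G 0∼v) v∉N) (λ ())

edgeSystem-isSystem : ∀ {n} (G : SimpleGraph (Fin n)) → IsSystem G (edgeSystem G)
edgeSystem-isSystem G zero    zero    0≢0 = contradiction refl 0≢0
edgeSystem-isSystem G zero    (suc v) _   = edgeSystem-zero G v
edgeSystem-isSystem G (suc u) zero    _   = mk⇔
  (λ u∼0 → trans (cong parity (together-comm (edgeSystem G) (suc u) zero))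
                 (Equivalence.to (edgeSystem-zero G u) (G .∼-sym u∼0)))
  (λ odd → G .∼-sym (Equivalence.from (edgeSystem-zero G u)
    (trans (cong parity (together-comm (edgeSystem G) zero (suc u))) odd)))
edgeSystem-isSystem G (suc u) (suc v) u≢v = mk⇔
  (λ u∼v → trans (edgeSystem-suc G u v) (Equivalence.to ih u∼v))
  (λ odd → Equivalence.from ih (trans (sym (edgeSystem-suc G u v)) odd))
  where ih = edgeSystem-isSystem (deleteZero G) u v (u≢v ∘ cong suc)

minimumSize : ∀ {n} (G : SimpleGraph (Fin n)) → ∃ (IsMinimum (HasSystemOfSize G))
minimumSize G = minimum (hasSystemOfSize? G) (length (edgeSystem G))
  (edgeSystem G , refl , edgeSystem-isSystem G)

c₂ : ∀ {n} → SimpleGraph (Fin n) → ℕ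
c₂ G = proj₁ (minimumSize G)

c₂-isMinimum : ∀ {n} (G : SimpleGraph (Fin n)) →
               IsMinimum (HasSystemOfSize G) (c₂ G)
c₂-isMinimum G = proj₂ (minimumSize G)

{-# OPTIONS --safe #-}

-- A system of at most k sets assigns to every vertex the vector of its
-- memberships in 𝔽₂ᵏ, and adjacency of distinct vertices becomes a fixed
-- symmetric relation B on the q = 2ᵏ vectors. So c₂(G) ≤ k says that G is a
-- blow-up of B. For any such B, being a blow-up is detected by the induced
-- subgraphs with at most 2q(q + 1) + 1 vertices. Indeed, if G is larger and
-- all G − v are blow-ups, then a blow-up structure of G − 0 and the adjacency
-- to 0 split the other vertices into 2q classes of pairwise twins, one of
-- which has q + 2 elements. Remove one of them, w, and take a blow-up
-- structure of G − w: two of the other q + 1 twins receive the same vector,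
-- and w may be given that vector as well. The forbidden graphs are therefore
-- those with at most 2q(q + 1) + 1 vertices and c₂ > k.
module Submission where

open import Data.Bool.Base using (Bool; true; false)
open import Data.Fin.Base
  using (Fin; zero; suc; punchIn; punchOut; combine; remQuot; funToFin; finToFun; inject≤; lift)
open import Data.Fin.Properties
  using (_≟_; any?; 2↔Bool; suc-injective; lift-injective; inject≤-injective; pigeonhole; <⇒≢;
         punchIn-injective; punchIn-punchOut; punchOut-injective;
         combine-injective; remQuot-combine; finToFun-funToFin)
open import Data.Fin.Subset using (Subset; ⊥; _∈_)
open import Data.Fin.Subset.Properties using (_∈?_; ∉⊥)
open import Data.List.Base as List using (List; []; _∷_; length; map; filter; concatMap; allFin; upTo)
open import Data.List.Membership.Propositional as List using (find; lose)
open import Data.List.Membership.Propositional.Properties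
  using (∈-filter⁺; ∈-filter⁻; ∈-concatMap⁺; ∈-map⁺; ∈-allFin; ∈-upTo⁺)
open import Data.List.Properties using (filter-reject; length-map; length-tabulate; tabulate-lookup)
open import Data.List.Relation.Binary.Pointwise as Pointwise using (Pointwise; []; _∷_)
open import Data.List.Relation.Unary.Any using (Any)
open import Data.Nat.Base
  using (ℕ; zero; suc; _+_; _*_; _^_; _≤_; _<_; _≤′_; ≤′-refl; ≤′-step; z≤n; s≤s; s≤s⁻¹; parity)
open import Data.Nat.Properties
  using (≤-refl; _≤?_; _<?_; ≮⇒≥; ≰⇒>; ≤⇒≤′; +-monoˡ-≤; +-cancelˡ-<; +-suc;
         module ≤-Reasoning)
open import Data.Parity.Base using (1ℙ)
import Data.Parity.Properties as Parity
open import Data.Product.Base using (∃; ∃₂; _×_; _,_; proj₁; proj₂)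
open import Data.Vec.Base as Vec using (lookup)
open import Data.Vec.Properties using ([]=⇒lookup; lookup⇒[]=; lookup∘tabulate)
open import Data.Vec.Properties.WithK using ([]=-irrelevant)
open import Function.Base using (_∘_; _on_; id)
open import Function.Bundles using (_⇔_; mk⇔; mk↔ₛ′; module Equivalence; module Inverse)
open import Function.Definitions using (Injective)
open import Relation.Binary.PropositionalEquality
  using (_≡_; _≢_; refl; sym; trans; cong; cong₂; subst; module ≡-Reasoning)
open import Relation.Nullary.Decidable
  using (Dec; yes; no; does; ¬?; _×-dec_; dec-true; does-⇔; decidable-stable)
open import Relation.Nullary.Negation using (¬_; contradiction)
open import Relation.Unary using (Pred; Decidable)
open import Level using (0ℓ)
open import Defs

open SimpleGraph

does-injective : ∀ {A B : Set} (a? : Dec A) (b? : Dec B) → does a? ≡ does b? → A ⇔ B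
does-injective (yes a) (yes b) _ = mk⇔ (λ _ → b) (λ _ → a)
does-injective (no ¬a) (no ¬b) _ = mk⇔ (λ a → contradiction a ¬a) (λ b → contradiction b ¬b)

-- Pigeonhole principle with multiplicities

-- By soundness the two ranges are disjoint, so injectivity and `total` make them a partition of
-- `Fin n`.
record Split {n} (P : Pred (Fin n) 0ℓ) : Set where
  field
    {#in #out}    : ℕ
    total         : #in + #out ≡ n
    inside        : Fin #in → Fin n
    out           : Fin #out → Fin n
    in-injective  : Injective _≡_ _≡_ inside
    out-injective : Injective _≡_ _≡_ out
    in-sound      : ∀ i → P (inside i)
    out-sound     : ∀ i → ¬ P (out i)

split : ∀ {n} {P : Pred (Fin n) 0ℓ} → Decidable P → Split P
split {zero} P? = record
  { total = refl ; inside = id ; out = id ; in-injective = id ; out-injective = id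
  ; in-sound = λ () ; out-sound = λ () }
split {suc n} P? with P? zero | split (P? ∘ suc)
... | yes p | s = record
  { total         = cong suc total
  ; inside        = lift 1 inside
  ; out           = suc ∘ out
  ; in-injective  = lift-injective inside in-injective 1
  ; out-injective = out-injective ∘ suc-injective
  ; in-sound      = λ { zero → p ; (suc i) → in-sound i }
  ; out-sound     = out-sound }
  where open Split s
... | no ¬p | s = record
  { total         = trans (+-suc #in #out) (cong suc total)
  ; inside        = suc ∘ inside
  ; out           = lift 1 out
  ; in-injective  = in-injective ∘ suc-injective
  ; out-injective = lift-injective out out-injective 1
  ; in-sound      = in-sound
  ; out-sound     = λ { zero → ¬p ; (suc i) → out-sound i } }
  where open Split s

-- Induction on the number of colours. If the fibre over `zero` has at most `d` elements, discard
-- it: more than `c * d` elements remain, and `punchOut` renumbers their `c` colours.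
largeFibre : ∀ c d {n} → c * d < n → (f : Fin n → Fin c) →
             ∃₂ λ y (g : Fin (suc d) → Fin n) → Injective _≡_ _≡_ g × (∀ i → f (g i) ≡ y)
largeFibre zero    d {suc n} _ f with () ← f zero
largeFibre (suc c) d {n} cd<n f with split (λ i → f i ≟ zero)
... | s with d <? Split.#in s
... | yes d<in = zero , inside ∘ (λ i → inject≤ i d<in) ,
      inject≤-injective d<in d<in _ _ ∘ in-injective , λ _ → in-sound _
  where open Split s
... | no d≮in = let y , g , g-injective , fg≡y = largeFibre c d cd<out (λ i → punchOut (0≢fout i)) in
      suc y , out ∘ g , g-injective ∘ out-injective , λ i →
      trans (sym (punchIn-punchOut (0≢fout (g i)))) (cong suc (fg≡y i))
  where
  open Split s
  0≢fout : ∀ i → zero ≢ f (out i)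
  0≢fout i = out-sound i ∘ sym
  cd<out : c * d < #out
  cd<out = +-cancelˡ-< d (c * d) #out (begin-strict
    d + c * d   <⟨ cd<n ⟩
    n           ≡⟨ total ⟨
    #in + #out  ≤⟨ +-monoˡ-≤ #out (≮⇒≥ d≮in) ⟩
    d + #out    ∎)
    where open ≤-Reasoning

-- Blow-ups of a fixed symmetric relation

Symm : {V : Set} → (V → V → Bool) → Set
Symm E = ∀ x y → E x y ≡ E y x

-- `a` and `b` are exempt because `Represents` ignores the diagonal: two vertices with one label are
-- twins whether adjacent or not.
Twins : {V : Set} → (V → V → Bool) → V → V → Set
Twins E a b = ∀ z → z ≢ a → z ≢ b → E a z ≡ E b z

module _ {q} (B : Fin q → Fin q → Bool) where

  Represents : {V : Set} → (V → V → Bool) → (V → Fin q) → Set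
  Represents E φ = ∀ x y → x ≢ y → E x y ≡ B (φ x) (φ y)

  Representable : {V : Set} → (V → V → Bool) → Set
  Representable E = ∃ (Represents E)

-- `q * 2` classes of `suc q` vertices each, and the vertex `zero` that is set aside.
radius : ℕ → ℕ
radius q = suc (q * 2 * suc q)

module _ {q} {B : Fin q → Fin q → Bool} (B-sym : Symm B) where

  -- The vertex `w` takes the label of `u`. The twin `u` justifies this at every vertex but `u`
  -- itself, where the second twin comes in.
  represent-twin : ∀ {n} {E : Fin (suc n) → Fin (suc n) → Bool} → Symm E →
    ∀ {w u u′} (w≢u : w ≢ u) (w≢u′ : w ≢ u′) → u ≢ u′ → Twins E w u → Twins E w u′ →
    ((ψ , _) : Representable B (E on punchIn w)) → ψ (punchOut w≢u) ≡ ψ (punchOut w≢u′) →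
    Representable B E
  represent-twin {n} {E} E-sym {w} {u} {u′} w≢u w≢u′ u≢u′ w~u w~u′ (ψ , ψ-rep) ψu≡ψu′ = φ , φ-rep
    where
    open ≡-Reasoning

    φ : Fin (suc n) → Fin q
    φ x with w ≟ x
    ... | yes _  = ψ (punchOut w≢u)
    ... | no w≢x = ψ (punchOut w≢x)

    off-w : ∀ {x y} (w≢x : w ≢ x) (w≢y : w ≢ y) → x ≢ y →
            E x y ≡ B (ψ (punchOut w≢x)) (ψ (punchOut w≢y))
    off-w w≢x w≢y x≢y =
      trans (sym (cong₂ E (punchIn-punchOut w≢x) (punchIn-punchOut w≢y)))
            (ψ-rep _ _ (x≢y ∘ punchOut-injective w≢x w≢y))

    at-w : ∀ {y} (w≢y : w ≢ y) → E w y ≡ B (ψ (punchOut w≢u)) (ψ (punchOut w≢y))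
    at-w {y} w≢y with y ≟ u
    ... | no y≢u   = trans (w~u y (w≢y ∘ sym) y≢u) (off-w w≢u w≢y (y≢u ∘ sym))
    -- That `w` and `u` are twins says nothing at `u`, so `u′`, with the same label, stands in for
    -- `u`.
    ... | yes refl = begin
      E w u                                        ≡⟨ w~u′ u (w≢u ∘ sym) u≢u′ ⟩
      E u′ u                                       ≡⟨ off-w w≢u′ w≢y (u≢u′ ∘ sym) ⟩
      B (ψ (punchOut w≢u′)) (ψ (punchOut w≢y))     ≡⟨ cong (λ a → B a (ψ (punchOut w≢y))) ψu≡ψu′ ⟨
      B (ψ (punchOut w≢u)) (ψ (punchOut w≢y))      ∎

    φ-rep : Represents B E φ
    φ-rep x y x≢y with w ≟ x | w ≟ y
    ... | yes refl | yes refl = contradiction refl x≢y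
    ... | yes refl | no w≢y   = at-w w≢y
    ... | no w≢x   | yes refl = trans (E-sym x w) (trans (at-w w≢x) (B-sym _ _))
    ... | no w≢x   | no w≢y   = off-w w≢x w≢y x≢y

  -- Induction on the number of vertices. Small subgraphs are given by injections, so that the
  -- hypothesis passes to vertex-deleted graphs by composition.
  representable-local : ∀ {n} {E : Fin n → Fin n → Bool} → Symm E →
    (∀ {m} → m ≤ radius q → (f : Fin m → Fin n) → Injective _≡_ _≡_ f → Representable B (E on f)) →
    Representable B E
  representable-local {zero}      E-sym local = local z≤n id id
  representable-local {suc n} {E} E-sym local with suc n ≤? radius q
  ... | yes n<r = local n<r id id
  ... | no n≮r
    with φ , φ-rep ← representable-local {E = E on suc} (λ x y → E-sym (suc x) (suc y))
                       (λ m≤r f f-inj → local m≤r (suc ∘ f) (f-inj ∘ suc-injective))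
    -- A colour is the label in the graph without `zero` together with adjacency to `zero`; more
    -- than `q * 2 * suc q` vertices share `q * 2` colours.
    with _ , g , g-injective , mono ←
      largeFibre (q * 2) (suc q) (s≤s⁻¹ (≰⇒> n≮r))
        (λ v → combine (φ v) (Inverse.from 2↔Bool (E (suc v) zero)))
    = conclude
    where
    t : Fin (suc (suc q)) → Fin (suc n)
    t = suc ∘ g

    t-injective : ∀ {i j} → i ≢ j → t i ≢ t j
    t-injective i≢j = i≢j ∘ g-injective ∘ suc-injective

    twins : ∀ i j → Twins E (t i) (t j)
    twins i j with combine-injective _ _ _ _ (trans (mono i) (sym (mono j)))
    ... | φi≡φj , Ei≡Ej = λ where
      -- The second half of the colour settles `zero`, the first half all other vertices.
      zero    _   _   → trans (sym (Inverse.strictlyInverseˡ 2↔Bool _))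
                          (trans (cong (Inverse.to 2↔Bool) Ei≡Ej) (Inverse.strictlyInverseˡ 2↔Bool _))
      (suc z) z≢i z≢j → trans (φ-rep _ _ (z≢i ∘ cong suc ∘ sym))
                          (trans (cong (λ a → B a (φ z)) φi≡φj) (sym (φ-rep _ _ (z≢j ∘ cong suc ∘ sym))))

    conclude : Representable B E
    conclude
      with ψ , ψ-rep ← representable-local {E = E on punchIn (t zero)} (λ _ _ → E-sym _ _)
             (λ m≤r f f-inj → local m≤r (punchIn (t zero) ∘ f) (f-inj ∘ punchIn-injective (t zero) _ _))
      -- The `suc q` twins other than `t zero` have only `q` labels available.
      with i , j , i<j , ψi≡ψj ←
        pigeonhole ≤-refl (λ i → ψ (punchOut (t-injective {zero} {suc i} λ ())))
      = represent-twin E-sym _ _ (t-injective (<⇒≢ i<j ∘ suc-injective))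
          (twins zero (suc i)) (twins zero (suc j)) (ψ , ψ-rep) ψi≡ψj

-- Systems of sets as blow-up structures

adjacent : ∀ {V} → SimpleGraph V → V → V → Bool
adjacent G u v = does (G ._∼?_ u v)

adjacent-sym : ∀ {V} (G : SimpleGraph V) → Symm (adjacent G)
adjacent-sym G u v = does-⇔ (mk⇔ (G .∼-sym) (G .∼-sym)) (G ._∼?_ u v) (G ._∼?_ v u)

does-∈? : ∀ {n} (u : Fin n) (S : Subset n) → does (u ∈? S) ≡ lookup S u
does-∈? zero    (true  Vec.∷ S) = refl
does-∈? zero    (false Vec.∷ S) = refl
does-∈? (suc u) (_     Vec.∷ S) = does-∈? u S

-- The two families may live on different vertex sets, so that a system for a graph can be compared
-- with the coordinate sets.
together-cong : ∀ {m n} {𝒞 : Family m} {𝒟 : Family n} {u v u′ v′} →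
  Pointwise (λ S T → lookup S u ≡ lookup T u′ × lookup S v ≡ lookup T v′) 𝒞 𝒟 →
  together 𝒞 u v ≡ together 𝒟 u′ v′
together-cong [] = refl
together-cong {𝒞 = S ∷ _} {T ∷ _} {u} {v} {u′} {v′} ((u≡ , v≡) ∷ 𝒞≈𝒟)
  rewrite does-∈? u S | does-∈? v S | does-∈? u′ T | does-∈? v′ T | u≡ | v≡
  with lookup T u′ | lookup T v′
... | true  | true  = cong suc (together-cong 𝒞≈𝒟)
... | true  | false = together-cong 𝒞≈𝒟
... | false | _     = together-cong 𝒞≈𝒟

-- Fin (2 ^ k) encodes 𝔽₂ᵏ; the i-th set consists of the vectors whose i-th
-- coordinate is 1.
coordinates : ∀ k → Family (2 ^ k)
coordinates k = List.tabulate λ (i : Fin k) → Vec.tabulate λ a → Inverse.to 2↔Bool (finToFun a i)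

odd? : ∀ {n} (𝒞 : Family n) u v → Dec (Odd (together 𝒞 u v))
odd? 𝒞 u v = parity (together 𝒞 u v) Parity.≟ 1ℙ

-- The standard bilinear form on 𝔽₂ᵏ: summing products over 𝔽₂ is counting common ones modulo 2.
dot : ∀ k → Fin (2 ^ k) → Fin (2 ^ k) → Bool
dot k a b = does (odd? (coordinates k) a b)

dot-sym : ∀ k → Symm (dot k)
dot-sym k a b = cong (λ t → does (parity t Parity.≟ 1ℙ)) (together-comm (coordinates k) a b)

-- The system consists of the preimages under `φ` of the coordinate sets.
representable⇒system : ∀ {k n} (G : SimpleGraph (Fin n)) →
                       Representable (dot k) (adjacent G) → HasSystemOfSize G k
representable⇒system {k} G (φ , φ-rep) =
  map pull (coordinates k) ,
  trans (length-map pull (coordinates k)) (length-tabulate {n = k} _) , λ u v u≢v →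
  subst (λ t → _ ⇔ Odd t) (sym (pull-together (coordinates k) u v))
    (does-injective (G ._∼?_ u v) (odd? (coordinates k) (φ u) (φ v)) (φ-rep u v u≢v))
  where
  pull : Subset (2 ^ k) → Subset _
  pull T = Vec.tabulate (lookup T ∘ φ)

  pull-together : ∀ 𝒟 u v → together (map pull 𝒟) u v ≡ together 𝒟 (φ u) (φ v)
  pull-together 𝒟 u v = together-cong (pointwise 𝒟)
    where
    pointwise : ∀ 𝒟 → Pointwise (λ S T → lookup S u ≡ lookup T (φ u) × lookup S v ≡ lookup T (φ v))
                                (map pull 𝒟) 𝒟
    pointwise []      = []
    pointwise (T ∷ 𝒟) = (lookup∘tabulate _ u , lookup∘tabulate _ v) ∷ pointwise 𝒟

-- Each vertex is labelled by its incidence vector with the members of the system.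
system⇒representable : ∀ {k n} (G : SimpleGraph (Fin n)) →
                       HasSystemOfSize G k → Representable (dot k) (adjacent G)
system⇒representable {n = n} G (𝒞 , refl , 𝒞-system) = φ , λ u v u≢v →
  trans (does-⇔ (𝒞-system u v u≢v) (G ._∼?_ u v) (odd? 𝒞 u v))
        (cong (λ t → does (parity t Parity.≟ 1ℙ)) (φ-together u v))
  where
  k = length 𝒞

  φ : Fin n → Fin (2 ^ k)
  φ u = funToFin λ i → Inverse.from 2↔Bool (lookup (List.lookup 𝒞 i) u)

  coordinate : ∀ u i →
    lookup (List.lookup 𝒞 i) u ≡ lookup (Vec.tabulate λ a → Inverse.to 2↔Bool (finToFun {2} {k} a i)) (φ u)
  coordinate u i = sym (trans (lookup∘tabulate _ (φ u))
    (trans (cong (Inverse.to 2↔Bool) (finToFun-funToFin {k} {2} _ i)) (Inverse.strictlyInverseˡ 2↔Bool _)))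

  φ-together : ∀ u v → together 𝒞 u v ≡ together (coordinates k) (φ u) (φ v)
  φ-together u v = trans (cong (λ 𝒟 → together 𝒟 u v) (sym (tabulate-lookup 𝒞)))
    (together-cong (Pointwise.tabulate⁺ λ i → coordinate u i , coordinate v i))

-- The empty set contains no pair, so adding it changes no count. Labels in 𝔽₂ᵏ come from exactly
-- `k` sets, while a minimum system may have fewer.
system-pad : ∀ {m k n} (G : SimpleGraph (Fin n)) → m ≤′ k → HasSystemOfSize G m → HasSystemOfSize G k
system-pad G ≤′-refl       s = s
system-pad G (≤′-step m≤k) s with 𝒞 , refl , 𝒞-system ← system-pad G m≤k s =
  ⊥ ∷ 𝒞 , refl , λ u v u≢v →
  subst (λ 𝒟 → _ ⇔ Odd (length 𝒟)) (sym (filter-reject (both? u v) (∉⊥ ∘ proj₁))) (𝒞-system u v u≢v)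

c₂≤⇔representable : ∀ {k n} (G : SimpleGraph (Fin n)) →
                    (c₂ G ≤ k) ⇔ Representable (dot k) (adjacent G)
c₂≤⇔representable {k} G = mk⇔
  (λ c₂≤k → system⇒representable G (system-pad G (≤⇒≤′ c₂≤k) (proj₁ (c₂-isMinimum G))))
  (λ rep → proj₂ (c₂-isMinimum G) k (representable⇒system {k} G rep))

-- Induced subgraphs and enumeration of finite graphs

induced : ∀ {V W} (G : SimpleGraph V) (f : W → V) → SimpleGraph W
induced G f ._∼_  x y       = G ._∼_ (f x) (f y)
induced G f .∼-sym          = G .∼-sym
induced G f .∼-irrefl x≡y   = G .∼-irrefl (cong f x≡y)
induced G f ._∼?_ x y       = G ._∼?_ (f x) (f y)

-- For `f = proj₁`, `induced G f` unfolds to `G [ S ]`, so this covers both heredity and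
-- isomorphism.
representable-≅ : ∀ {q} {B : Fin q → Fin q → Bool} {V W X} {G : SimpleGraph V} {H : SimpleGraph W}
  (f : X → V) → Injective _≡_ _≡_ f → induced G f ≅ H →
  Representable B (adjacent G) → Representable B (adjacent H)
representable-≅ {B = B} {G = G} {H} f f-inj G≅H (φ , φ-rep) = φ ∘ f ∘ from , λ x y x≢y →
  trans (sym (cong₂ (adjacent H) (strictlyInverseˡ x) (strictlyInverseˡ y)))
  (trans (sym (does-⇔ (adjacency (from x) (from y)) (G ._∼?_ _ _) (H ._∼?_ _ _)))
         (φ-rep _ _ λ eq → x≢y (trans (sym (strictlyInverseˡ x))
           (trans (cong to (f-inj eq)) (strictlyInverseˡ y)))))
  where
  open _≅_ G≅H
  open Inverse bijection

∃∈-injective : ∀ {n} {S : Subset n} → Injective _≡_ _≡_ (proj₁ {B = _∈ S})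
∃∈-injective {x = _ , _} {y = _ , _} refl = cong (_ ,_) ([]=-irrelevant _ _)

image : ∀ {m n} → (Fin m → Fin n) → Subset n
image f = Vec.tabulate λ v → does (any? λ i → f i ≟ v)

-- Bridges the injections of `representable-local` and the subsets of the theorem.
image-≅ : ∀ {m n} (G : SimpleGraph (Fin n)) {H : SimpleGraph (Fin m)} (f : Fin m → Fin n) →
  Injective _≡_ _≡_ f → (∀ x y → (G ._∼_ (f x) (f y)) ⇔ (H ._∼_ x y)) → (G [ image f ]) ≅ H
image-≅ {m} {n} G {H} f f-inj adj = record
  { bijection = mk↔ₛ′ (λ (v , v∈) → proj₁ (preimage v∈)) (λ i → f i , ∈-image i)
      (λ i → f-inj (proj₂ (preimage (∈-image i))))
      (λ (v , v∈) → ∃∈-injective (proj₂ (preimage v∈)))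
  ; adjacency = λ (u , u∈) (v , v∈) →
      subst (λ e → e ⇔ (H ._∼_ (proj₁ (preimage u∈)) (proj₁ (preimage v∈))))
            (cong₂ (G ._∼_) (proj₂ (preimage u∈)) (proj₂ (preimage v∈))) (adj _ _)
  }
  where
  preimage : ∀ {v} → v ∈ image f → ∃ λ i → f i ≡ v
  preimage {v} v∈ with any? (λ i → f i ≟ v) | trans (sym (lookup∘tabulate _ v)) ([]=⇒lookup v∈)
  ... | yes i | _ = i

  ∈-image : ∀ i → f i ∈ image f
  ∈-image i = lookup⇒[]= (f i) _ (trans (lookup∘tabulate _ (f i)) (dec-true (any? _) (i , refl)))

-- A code is a Boolean matrix; requiring distinct vertices and both entries
-- makes every code a graph.
decode : ∀ m → Fin (2 ^ (m * m)) → SimpleGraph (Fin m)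
decode m c ._∼_ x y = x ≢ y × entry x y ≡ suc zero × entry y x ≡ suc zero
  where
  entry : Fin m → Fin m → Fin 2
  entry x y = finToFun c (combine x y)
decode m c .∼-sym (x≢y , xy , yx) = x≢y ∘ sym , yx , xy
decode m c .∼-irrefl x≡y (x≢y , _) = x≢y x≡y
decode m c ._∼?_ x y = ¬? (x ≟ y) ×-dec (_ ≟ _) ×-dec (_ ≟ _)

encode : ∀ {m} → SimpleGraph (Fin m) → Fin (2 ^ (m * m))
encode {m} G = funToFin λ p → let x , y = remQuot {m} m p in Inverse.from 2↔Bool (adjacent G x y)

-- Hence every graph on `Fin m` occurs among the decoded ones, with equivalent rather than equal
-- adjacency.
decode-encode : ∀ {m} (G : SimpleGraph (Fin m)) x y →
                (G ._∼_ x y) ⇔ (decode m (encode G) ._∼_ x y)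
decode-encode {m} G x y = mk⇔
  (λ x∼y → (λ x≡y → G .∼-irrefl x≡y x∼y) , entry-true x∼y , entry-true (G .∼-sym x∼y))
  (λ (_ , xy , _) → entry-sound xy)
  where
  entry : ∀ x y → finToFun (encode G) (combine x y) ≡ Inverse.from 2↔Bool (adjacent G x y)
  entry x y = trans (finToFun-funToFin {m * m} {2} _ (combine x y))
    (cong (λ (x , y) → Inverse.from 2↔Bool (adjacent G x y)) (remQuot-combine x y))

  entry-true : ∀ {x y} → G ._∼_ x y → finToFun (encode G) (combine x y) ≡ suc zero
  entry-true {x} {y} x∼y = trans (entry x y) (cong (Inverse.from 2↔Bool) (dec-true (G ._∼?_ x y) x∼y))

  entry-sound : ∀ {x y} → finToFun (encode G) (combine x y) ≡ suc zero → G ._∼_ x y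
  entry-sound {x} {y} eq with G ._∼?_ x y | trans (sym (entry x y)) eq
  ... | yes x∼y | _ = x∼y

graphsOfSize : ℕ → List FiniteGraph
graphsOfSize m = map (λ c → m , decode m c) (allFin (2 ^ (m * m)))

graphsUpTo : ℕ → List FiniteGraph
graphsUpTo N = concatMap graphsOfSize (upTo (suc N))

∈-graphsUpTo : ∀ {m N} → m ≤ N → ∀ c → (m , decode m c) List.∈ graphsUpTo N
∈-graphsUpTo m≤N c = ∈-concatMap⁺ graphsOfSize
  (lose (∈-upTo⁺ (s≤s m≤N)) (∈-map⁺ (λ c → _ , decode _ c) (∈-allFin c)))

theorem5p3 : ∀ (k : ℕ) → ∃ λ (M : List FiniteGraph) →
    ∀ {n} (G : SimpleGraph (Fin n)) →
    (c₂ G ≤ k) ⇔ (¬ (∃ λ (S : Subset n) → Any (λ H → (G [ S ]) ≅ proj₂ H) M))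
theorem5p3 k = filter obstruction? (graphsUpTo N) , λ G → mk⇔ (excludes G) (suffices G)
  where
  N : ℕ
  N = radius (2 ^ k)

  obstruction? : Decidable λ (H : FiniteGraph) → ¬ (c₂ (proj₂ H) ≤ k)
  obstruction? (_ , H) = ¬? (c₂ H ≤? k)

  M : List FiniteGraph
  M = filter obstruction? (graphsUpTo N)

  Contains : ∀ {n} → SimpleGraph (Fin n) → Set₁
  Contains {n} G = ∃ λ (S : Subset n) → Any (λ H → (G [ S ]) ≅ proj₂ H) M

  excludes : ∀ {n} (G : SimpleGraph (Fin n)) → c₂ G ≤ k → ¬ Contains G
  excludes G c₂≤k (S , G[S]∈M) with (_ , H) , H∈M , G[S]≅H ← find G[S]∈M =
    proj₂ (∈-filter⁻ obstruction? {xs = graphsUpTo N} H∈M)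
      (Equivalence.from (c₂≤⇔representable H)
        (representable-≅ {B = dot k} {G = G} {H} proj₁ ∃∈-injective G[S]≅H
          (Equivalence.to (c₂≤⇔representable G) c₂≤k)))

  suffices : ∀ {n} (G : SimpleGraph (Fin n)) → ¬ Contains G → c₂ G ≤ k
  suffices {n} G free = Equivalence.from (c₂≤⇔representable G)
    (representable-local (dot-sym k) {E = adjacent G} (adjacent-sym G) local)
    where
    local : ∀ {m} → m ≤ N → (f : Fin m → Fin n) → Injective _≡_ _≡_ f →
            Representable (dot k) (adjacent G on f)
    local {m} m≤N f f-inj =
      -- `M` lists decoded graphs, so the decoded copy `H` is tested. Were `c₂ H` above `k`, `H`
      -- would be in `M` and `G` would contain it. Hence `H` has a labelling, which serves `G∘f` as
      -- well.
      let φ , φ-rep = Equivalence.to (c₂≤⇔representable H) (decidable-stable (c₂ H ≤? k) λ c₂≰k →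
            free (image f , lose (∈-filter⁺ obstruction? (∈-graphsUpTo m≤N _) c₂≰k)
                                 (image-≅ G f f-inj (decode-encode G∘f))))
      in φ , λ x y x≢y →
        trans (does-⇔ (decode-encode G∘f x y) (G∘f ._∼?_ x y) (H ._∼?_ x y)) (φ-rep x y x≢y)
      where
      G∘f H : SimpleGraph (Fin m)
      G∘f = induced G f
      H = decode m (encode G∘f)
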